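{- Let $p>3$ be a prime. For $c,d\in\mathbb{Z}$ put $$D_p(c,d):=\det[(i^2+cij+dj^2)^{p-2}]_{1\le i,j\le p-1}.$$ (i) If $p\equiv 3\pmod 4$, then $D_p(c,-1)\equiv 0\pmod p$ for all $c\in\mathbb{Z}$. (ii) If $p\equiv 3\pmod 4$, then $D_p(2,2)\equiv 0\pmod p$. If $p\equiv\pm1\pmod{12}$, then $D_p(6,6)\equiv 0\pmod p$.
   Context: $[a_{ij}]_{1\le i,j\le p-1}$ denotes the $(p-1)\times(p-1)$ integer matrix with rows and columns indexed by $1,\ldots,p-1$ whose $(i,j)$ entry is $a_{ij}$. -}

module Defs where

open import Data.Fin using (Fin; zero; suc; toℕ)
open import Data.Integer using (ℤ; +_; _+_; _-_; _*_; _^_; 1ℤ; -1ℤ)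
open import Data.Integer.Divisibility.Signed using (_∣_)
open import Data.Integer.Properties using (+-0-commutativeMonoid)
open import Data.Nat using (ℕ; zero; suc; _∸_)
open import Data.Vec.Functional using (Vector; removeAt; tail)

open import Algebra.Properties.CommutativeMonoid.Sum +-0-commutativeMonoid using (sum-syntax)

infix 4 _≡_[mod_]

_≡_[mod_] : ℤ → ℤ → ℕ → Set
a ≡ b [mod n ] = + n ∣ a - b

Matrix : ℕ → ℕ → Set
Matrix m n = Vector (Vector ℤ n) m

-- Laplace expansion along the first row.  Counting the columns from 0, the
-- cofactor of column j carries the sign (-1)^j.
det : ∀ {n} → Matrix n n → ℤ
det {zero}  A = 1ℤ
det {suc n} A =
  ∑[ j < suc n ] (-1ℤ ^ toℕ j * A zero j * det (λ i → removeAt (tail A i) j))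

-- The integer of the range 1, …, n that a row or column index stands for.
index : ∀ {n} → Fin n → ℤ
index i = + suc (toℕ i)

-- Truncated subtraction agrees with ordinary subtraction here for p ≥ 2.
D : ℕ → ℤ → ℤ → ℤ
D p c d = det {p ∸ 1} λ i j →
  (index i ^ 2 + c * index i * index j + d * index j ^ 2) ^ (p ∸ 2)

{-# OPTIONS --safe #-}
module Submission where

-- Modulo p the matrix is singular as soon as some vector with entries j ^ k, k > 0,
-- lies in its kernel.  The substitution j = i t turns all rows of this condition into
-- the single congruence Σ t ^ k (1 + c t + d t²) ^ (p - 2) ≡ 0, the sum being over
-- all residues t, and x ^ (p - 2) is the inverse of x, or 0 if x ≡ 0.
-- For d = -1 take k = (p + 1) / 2: the substitution t ↦ - 1 / t changes the sign of the
-- sum.  For c = d take k = 2 and use the symmetry t ↦ - 1 - t.  If c = d = 2 the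
-- quadratic has no zero since - 1 is not a square; if c = d = 6 it splits since 3 is a
-- square, and partial fractions reduce the sum to sums of inverses, which vanish.
-- A square root of 3 comes from elements of orders 3 and 4 if p ≡ 1 (mod 12), and is
-- 3 ^ ((p + 1) / 4) if p ≡ - 1 (mod 12), as - 3 is not a square then.

open import Defs
open import Data.Integer using (ℤ; +_; -1ℤ; 0ℤ; 1ℤ; _+_; _*_; _-_; -_; _^_; ∣_∣)
open import Data.Integer.DivMod using (_%ℕ_; _/ℕ_; n%ℕd<d; a≡a%ℕn+[a/ℕn]*n)
open import Data.Integer.Divisibility.Signed using (_∣_; _∣?_; divides; ∣m∣n⇒∣m+n; ∣n⇒∣m*n; ∣m⇒∣m*n; ∣⇒∣ᵤ; ∣ᵤ⇒∣)
open import Data.Integer.Properties using (+-identityʳ; +-0-commutativeMonoid; +-*-semiring; *-1-commutativeMonoid; abs-*; pos-*; ^-*-assoc; ^-zeroˡ)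
open import Data.Integer.Tactic.RingSolver using (solve-∀)
open import Data.Fin using (Fin; zero; suc; toℕ; inject₁; punchIn; punchOut; fromℕ<; inject≤)
open import Data.Fin.Induction using (<-weakInduction)
open import Data.Fin.Permutation using (Permutation; permutation; _⟨$⟩ʳ_)
open import Data.Fin.Properties using (_≟_; any?; punchIn-injective; punchInᵢ≢i; punchIn-punchOut; suc-injective; toℕ<n; toℕ-fromℕ<; toℕ-injective; toℕ-inject₁; inject≤-injective)
open import Data.Nat as ℕ using (ℕ; zero; suc; _>_; _<_; s≤s; s<s; z<s)
open import Data.Nat.Coprimality using (prime⇒coprime; coprime-Bézout)
import Data.Nat.Divisibility as ℕ
import Data.Nat.GCD as GCD
import Data.Nat.Properties as ℕ
open import Data.Nat.Primality using (Prime; euclidsLemma)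
open import Data.Product using (_×_; _,_; ∃; proj₁; proj₂)
open import Data.Sum using (_⊎_; inj₁; inj₂; [_,_]′)
open import Data.Vec using (Vec; []; _∷_; replicate)
open import Data.Vec.Functional using (removeAt; tail)
open import Function using (_∘_; id)
open import Relation.Binary using (Setoid; tri<; tri≈; tri>)
open import Relation.Binary.PropositionalEquality
open import Relation.Nullary using (¬_; Dec; yes; no; contradiction; map′; ¬?; decidable-stable)
open import Algebra.Properties.CommutativeMonoid.Sum +-0-commutativeMonoid using (sum; sum-cong-≗; sum-remove; sum-permute; ∑-distrib-+)
open import Algebra.Properties.CommutativeMonoid.Sum *-1-commutativeMonoid using () renaming (sum to product; sum-permute to product-permute)
open import Algebra.Properties.Semiring.Sum +-*-semiring using (*-distribˡ-sum; *-distribʳ-sum)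
import Relation.Binary.Reasoning.Setoid as SetoidReasoning

-- Determinants: linearity in one column, and minors at adjacent columns.

minor : ∀ {n} → Matrix (suc n) (suc n) → Fin (suc n) → Matrix n n
minor A j i = removeAt (tail A i) j

det-cong : ∀ {n} {A B : Matrix n n} → (∀ i j → A i j ≡ B i j) → det A ≡ det B
det-cong {zero} eq = refl
det-cong {suc n} eq = sum-cong-≗ λ j →
  cong₂ (λ a d → -1ℤ ^ toℕ j * a * d) (eq zero j) (det-cong λ i l → eq (suc i) (punchIn j l))

-- Induction along the first-row expansion. The term of column `k` has a linear entry and a minor
-- that omits column `k`; every other term has a fixed entry and a minor that contains column `k` at
-- position `punchOut j≢k`.
det-linear-column : ∀ {n} (A B C : Matrix n n) (k : Fin n) (x y : ℤ) →
  (∀ i → C i k ≡ x * A i k + y * B i k) →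
  (∀ i j → j ≢ k → A i j ≡ C i j) → (∀ i j → j ≢ k → B i j ≡ C i j) →
  det C ≡ x * det A + y * det B
det-linear-column {suc n} A B C k x y C≡ A≡ B≡ = begin
  det C                                            ≡⟨ sum-cong-≗ expand ⟩
  sum (λ j → x * term A j + y * term B j)          ≡⟨ ∑-distrib-+ (λ j → x * term A j) (λ j → y * term B j) ⟩
  sum (λ j → x * term A j) + sum (λ j → y * term B j)
    ≡⟨ cong₂ _+_ (*-distribˡ-sum x (term A)) (*-distribˡ-sum y (term B)) ⟨
  x * det A + y * det B                            ∎
  where
  open ≡-Reasoning
  term : Matrix (suc n) (suc n) → Fin (suc n) → ℤ
  term M j = -1ℤ ^ toℕ j * M zero j * det (minor M j)

  entry-distrib : ∀ s x y a b d → s * (x * a + y * b) * d ≡ x * (s * a * d) + y * (s * b * d)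
  entry-distrib = solve-∀

  minor-distrib : ∀ s c x y a b → s * c * (x * a + y * b) ≡ x * (s * c * a) + y * (s * c * b)
  minor-distrib = solve-∀

  expand : ∀ j → term C j ≡ x * term A j + y * term B j
  expand j with j ≟ k
  ... | yes refl = begin
    s * C zero j * det (minor C j)
      ≡⟨ cong (λ c → s * c * det (minor C j)) (C≡ zero) ⟩
    s * (x * A zero j + y * B zero j) * det (minor C j)
      ≡⟨ entry-distrib s x y (A zero j) (B zero j) _ ⟩
    x * (s * A zero j * det (minor C j)) + y * (s * B zero j * det (minor C j))
      ≡⟨ cong₂ (λ a b → x * (s * A zero j * a) + y * (s * B zero j * b))
           (det-cong λ i l → sym (A≡ (suc i) (punchIn j l) (punchInᵢ≢i j l)))
           (det-cong λ i l → sym (B≡ (suc i) (punchIn j l) (punchInᵢ≢i j l))) ⟩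
    x * term A j + y * term B j ∎
    where s = -1ℤ ^ toℕ j
  ... | no j≢k = begin
    s * C zero j * det (minor C j)
      ≡⟨ cong (s * C zero j *_) (det-linear-column (minor A j) (minor B j) (minor C j) k′ x y
           (λ i → subst (λ l → C (suc i) l ≡ x * A (suc i) l + y * B (suc i) l) (sym k′↦k) (C≡ (suc i)))
           (λ i l l≢k′ → A≡ (suc i) (punchIn j l) (l≢k′ ∘ back))
           (λ i l l≢k′ → B≡ (suc i) (punchIn j l) (l≢k′ ∘ back))) ⟩
    s * C zero j * (x * det (minor A j) + y * det (minor B j))
      ≡⟨ minor-distrib s (C zero j) x y _ _ ⟩
    x * (s * C zero j * det (minor A j)) + y * (s * C zero j * det (minor B j))
      ≡⟨ cong₂ (λ a b → x * (s * a * det (minor A j)) + y * (s * b * det (minor B j)))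
           (sym (A≡ zero j j≢k)) (sym (B≡ zero j j≢k)) ⟩
    x * term A j + y * term B j ∎
    where
    s = -1ℤ ^ toℕ j
    k′ = punchOut j≢k
    k′↦k = punchIn-punchOut j≢k
    back : ∀ {l} → punchIn j l ≡ k → l ≡ k′
    back eq = punchIn-injective j _ _ (trans eq (sym k′↦k))

-- Together with the next two lemmas: the minors at columns `j` and `j + 1` differ only in column
-- `j`, so that linearity in that column can combine them.
punchIn-inject₁ : ∀ {n} (j : Fin n) → punchIn (inject₁ j) j ≡ suc j
punchIn-inject₁ zero = refl
punchIn-inject₁ (suc j) = cong suc (punchIn-inject₁ j)

punchIn-suc : ∀ {n} (j : Fin n) → punchIn (suc j) j ≡ inject₁ j
punchIn-suc zero = refl
punchIn-suc (suc j) = cong suc (punchIn-suc j)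

punchIn-adjacent : ∀ {n} (j l : Fin n) → l ≢ j → punchIn (inject₁ j) l ≡ punchIn (suc j) l
punchIn-adjacent zero zero l≢j = contradiction refl l≢j
punchIn-adjacent zero (suc l) l≢j = refl
punchIn-adjacent (suc j) zero l≢j = refl
punchIn-adjacent (suc j) (suc l) l≢j = cong suc (punchIn-adjacent j l (l≢j ∘ cong suc))

^-distribʳ-* : ∀ x y k → (x * y) ^ k ≡ x ^ k * y ^ k
^-distribʳ-* x y zero = refl
^-distribʳ-* x y (suc k) = begin
  x * y * (x * y) ^ k       ≡⟨ cong (x * y *_) (^-distribʳ-* x y k) ⟩
  x * y * (x ^ k * y ^ k)   ≡⟨ interchange x y (x ^ k) (y ^ k) ⟩
  x * x ^ k * (y * y ^ k)   ∎
  where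
  open ≡-Reasoning
  interchange : ∀ a b c d → a * b * (c * d) ≡ a * c * (b * d)
  interchange = solve-∀

-- Arithmetic modulo the prime `p = n + 2`.

module PrimeField (n : ℕ) (p-prime : Prime (2 ℕ.+ n)) (p>3 : 2 ℕ.+ n > 3) where

  p : ℕ
  p = 2 ℕ.+ n

  infix 4 _≈_ _≉_ _≈?_

  -- A wrapper of congruence modulo p from which Agda can recover x and y.
  record _≈_ (x y : ℤ) : Set where
    constructor mod
    field congruent : x ≡ y [mod p ]

  open _≈_ public

  _≉_ : ℤ → ℤ → Set
  x ≉ y = ¬ x ≈ y

  ≈-reflexive : ∀ {x y} → x ≡ y → x ≈ y
  ≈-reflexive {x} refl = mod (divides 0ℤ (x-x≡0 x))
    where
    x-x≡0 : ∀ x → x - x ≡ 0ℤ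
    x-x≡0 = solve-∀

  ≈-refl : ∀ {x} → x ≈ x
  ≈-refl = ≈-reflexive refl

  ≈-trans : ∀ {x y z} → x ≈ y → y ≈ z → x ≈ z
  ≈-trans {x} {y} {z} (mod x≡y) (mod y≡z) = mod (subst (+ p ∣_) (telescope x y z) (∣m∣n⇒∣m+n x≡y y≡z))
    where
    telescope : ∀ x y z → (x - y) + (y - z) ≡ x - z
    telescope = solve-∀

  ≈-sym : ∀ {x y} → x ≈ y → y ≈ x
  ≈-sym {x} {y} (mod x≡y) = mod (subst (+ p ∣_) (swap x y) (∣n⇒∣m*n -1ℤ x≡y))
    where
    swap : ∀ x y → -1ℤ * (x - y) ≡ y - x
    swap = solve-∀

  ≈-setoid : Setoid _ _
  ≈-setoid = record
    { Carrier = ℤ ; _≈_ = _≈_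
    ; isEquivalence = record { refl = ≈-refl ; sym = ≈-sym ; trans = ≈-trans } }

  module ≈-Reasoning = SetoidReasoning ≈-setoid

  _≈?_ : ∀ x y → Dec (x ≈ y)
  x ≈? y = map′ mod congruent (+ p ∣? (x - y))

  +-cong : ∀ {x y u v} → x ≈ y → u ≈ v → x + u ≈ y + v
  +-cong {x} {y} {u} {v} (mod x≡y) (mod u≡v) = mod (subst (+ p ∣_) (regroup x y u v) (∣m∣n⇒∣m+n x≡y u≡v))
    where
    regroup : ∀ x y u v → (x - y) + (u - v) ≡ (x + u) - (y + v)
    regroup = solve-∀

  *-cong : ∀ {x y u v} → x ≈ y → u ≈ v → x * u ≈ y * v
  *-cong {x} {y} {u} {v} (mod x≡y) (mod u≡v) =
    mod (subst (+ p ∣_) (regroup x y u v) (∣m∣n⇒∣m+n (∣m⇒∣m*n u x≡y) (∣n⇒∣m*n y u≡v)))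
    where
    regroup : ∀ x y u v → (x - y) * u + y * (u - v) ≡ x * u - y * v
    regroup = solve-∀

  *-congˡ : ∀ x {u v} → u ≈ v → x * u ≈ x * v
  *-congˡ x = *-cong (≈-refl {x})

  *-congʳ : ∀ x {u v} → u ≈ v → u * x ≈ v * x
  *-congʳ x u≈v = *-cong u≈v (≈-refl {x})

  neg-cong : ∀ {x y} → x ≈ y → - x ≈ - y
  neg-cong {x} {y} x≈y = subst₂ _≈_ (-1*x≡-x x) (-1*x≡-x y) (*-congˡ -1ℤ x≈y)
    where
    -1*x≡-x : ∀ x → -1ℤ * x ≡ - x
    -1*x≡-x = solve-∀

  ^-cong : ∀ k {x y} → x ≈ y → x ^ k ≈ y ^ k
  ^-cong zero x≈y = ≈-refl
  ^-cong (suc k) x≈y = *-cong x≈y (^-cong k x≈y)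

  sum-cong : ∀ {m} {f g : Fin m → ℤ} → (∀ i → f i ≈ g i) → sum f ≈ sum g
  sum-cong {zero} f≈g = ≈-refl
  sum-cong {suc m} f≈g = +-cong (f≈g zero) (sum-cong (f≈g ∘ suc))

  product-cong : ∀ {m} {f g : Fin m → ℤ} → (∀ i → f i ≈ g i) → product f ≈ product g
  product-cong {zero} f≈g = ≈-refl
  product-cong {suc m} f≈g = *-cong (f≈g zero) (product-cong (f≈g ∘ suc))

  ≈0⇒p∣ : ∀ {x} → x ≈ 0ℤ → p ℕ.∣ ∣ x ∣
  ≈0⇒p∣ {x} (mod x≡0) = ∣⇒∣ᵤ (subst (+ p ∣_) (x-0≡x x) x≡0)
    where
    x-0≡x : ∀ x → x - 0ℤ ≡ x
    x-0≡x = solve-∀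

  p∣⇒≈0 : ∀ {x} → p ℕ.∣ ∣ x ∣ → x ≈ 0ℤ
  p∣⇒≈0 {x} p∣x = mod (subst (+ p ∣_) (x≡x-0 x) (∣ᵤ⇒∣ p∣x))
    where
    x≡x-0 : ∀ x → x ≡ x - 0ℤ
    x≡x-0 = solve-∀

  zero-product : ∀ x y → x * y ≈ 0ℤ → x ≈ 0ℤ ⊎ y ≈ 0ℤ
  zero-product x y xy≈0 with euclidsLemma ∣ x ∣ ∣ y ∣ p-prime (subst (p ℕ.∣_) (abs-* x y) (≈0⇒p∣ xy≈0))
  ... | inj₁ p∣x = inj₁ (p∣⇒≈0 p∣x)
  ... | inj₂ p∣y = inj₂ (p∣⇒≈0 p∣y)

  *-nonzero : ∀ {x y} → x ≉ 0ℤ → y ≉ 0ℤ → x * y ≉ 0ℤ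
  *-nonzero {x} {y} x≉0 y≉0 xy≈0 = [ x≉0 , y≉0 ]′ (zero-product x y xy≈0)

  *-zeroʳ : ∀ x {y} → y ≈ 0ℤ → x * y ≈ 0ℤ
  *-zeroʳ x y≈0 = ≈-trans (*-congˡ x y≈0) (≈-reflexive (x*0≡0 x))
    where
    x*0≡0 : ∀ x → x * 0ℤ ≡ 0ℤ
    x*0≡0 = solve-∀

  *-zeroˡ : ∀ {x} y → x ≈ 0ℤ → x * y ≈ 0ℤ
  *-zeroˡ y x≈0 = ≈-trans (*-congʳ y x≈0) (≈-reflexive (0*x≡0 y))
    where
    0*x≡0 : ∀ x → 0ℤ * x ≡ 0ℤ
    0*x≡0 = solve-∀

  difference-zero : ∀ {x y} → x - y ≈ 0ℤ → x ≈ y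
  difference-zero {x} {y} x-y≈0 = subst₂ _≈_ (lhs x y) (rhs y) (+-cong x-y≈0 (≈-refl {y}))
    where
    lhs : ∀ x y → x - y + y ≡ x
    lhs = solve-∀
    rhs : ∀ y → 0ℤ + y ≡ y
    rhs = solve-∀

  zero-difference : ∀ {x y} → x ≈ y → x - y ≈ 0ℤ
  zero-difference {x} {y} x≈y = ≈-trans (+-cong x≈y (≈-refl { - y})) (≈-reflexive (y-y≡0 y))
    where
    y-y≡0 : ∀ y → y - y ≡ 0ℤ
    y-y≡0 = solve-∀

  -- Leaves only a ring identity to the solver when a congruence follows from a known one.
  modulo : ∀ {x y u v} z → u ≈ v → x ≡ y + z * (u - v) → x ≈ y
  modulo {x} {y} {u} {v} z u≈v x≡ = begin
    x                ≡⟨ x≡ ⟩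
    y + z * (u - v)  ≈⟨ +-cong (≈-refl {y}) (*-zeroʳ z (zero-difference u≈v)) ⟩
    y + 0ℤ           ≡⟨ +-identityʳ y ⟩
    y                ∎
    where open ≈-Reasoning

  *-cancelˡ-0 : ∀ {c} x → c ≉ 0ℤ → c * x ≈ 0ℤ → x ≈ 0ℤ
  *-cancelˡ-0 {c} x c≉0 cx≈0 = [ (λ c≈0 → contradiction c≈0 c≉0) , id ]′ (zero-product c x cx≈0)

  *-cancelˡ : ∀ {c} x y → c ≉ 0ℤ → c * x ≈ c * y → x ≈ y
  *-cancelˡ {c} x y c≉0 cx≈cy = difference-zero {x} {y}
    (*-cancelˡ-0 (x - y) c≉0 (≈-trans (≈-reflexive (factor c x y)) (zero-difference cx≈cy)))
    where
    factor : ∀ c x y → c * (x - y) ≡ c * x - c * y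
    factor = solve-∀

  positive≉0 : ∀ k → suc k < p → + suc k ≉ 0ℤ
  positive≉0 k k<p k≈0 = ℕ.<⇒≱ k<p (ℕ.∣⇒≤ (≈0⇒p∣ k≈0))

  1≉0 : 1ℤ ≉ 0ℤ
  1≉0 = positive≉0 0 (s<s z<s)

  ^-nonzero : ∀ k {x} → x ≉ 0ℤ → x ^ k ≉ 0ℤ
  ^-nonzero zero x≉0 = 1≉0
  ^-nonzero (suc k) x≉0 = *-nonzero x≉0 (^-nonzero k x≉0)

  product-nonzero : ∀ {m} {f : Fin m → ℤ} → (∀ i → f i ≉ 0ℤ) → product f ≉ 0ℤ
  product-nonzero {zero} f≉0 = 1≉0
  product-nonzero {suc m} f≉0 = *-nonzero (f≉0 zero) (product-nonzero (f≉0 ∘ suc))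

  -- Singular matrices modulo `p`.

  -- The cofactors of the first row are proportional to `v`, so `v zero * det A` is a multiple of
  -- the first entry of `A v`. The proportionality rests on this lemma for matrices one size
  -- smaller.
  det-singular : ∀ {m} (A : Matrix (suc m) (suc m)) (v : Fin (suc m) → ℤ) → (∀ j → v j ≉ 0ℤ) →
    (∀ i → sum (λ j → A i j * v j) ≈ 0ℤ) → det A ≈ 0ℤ

  cofactor : ∀ {m} → Matrix (suc m) (suc m) → Fin (suc m) → ℤ
  cofactor A j = -1ℤ ^ toℕ j * det (minor A j)

  -- Merging columns j and j + 1 with the weights v j and v (j + 1) gives a smaller
  -- singular matrix, and linearity in the merged column turns this into the claim.
  cofactor-adjacent : ∀ {m} (A : Matrix (suc m) (suc m)) (v : Fin (suc m) → ℤ) → (∀ j → v j ≉ 0ℤ) →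
    (∀ i → sum (λ j → A i j * v j) ≈ 0ℤ) → (j : Fin m) →
    v (suc j) * cofactor A (inject₁ j) ≈ v (inject₁ j) * cofactor A (suc j)
  cofactor-adjacent {suc m} A v v≉0 Av≈0 j = difference-zero (begin
    v (suc j) * cofactor A (inject₁ j) - v (inject₁ j) * cofactor A (suc j)
      ≡⟨ cong (λ s → v (suc j) * (s * dˡ) - v (inject₁ j) * (-1ℤ * σ * dʳ)) (cong (-1ℤ ^_) (toℕ-inject₁ j)) ⟩
    v (suc j) * (σ * dˡ) - v (inject₁ j) * (-1ℤ * σ * dʳ)
      -- Adjacent cofactors carry opposite signs, which turns the difference into the sum that
      -- linearity in column `j` gives for `det M`.
      ≡⟨ collect σ (v (suc j)) (v (inject₁ j)) dˡ dʳ ⟩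
    σ * (v (suc j) * dˡ + v (inject₁ j) * dʳ)
      ≡⟨ cong (σ *_) (det-linear-column (minor A (inject₁ j)) (minor A (suc j)) M j
           (v (suc j)) (v (inject₁ j)) M-merged M-left M-right) ⟨
    σ * det M
      ≈⟨ *-zeroʳ σ (det-singular M w w≉0 Mw≈0) ⟩
    0ℤ ∎)
    where
    open ≈-Reasoning
    σ = -1ℤ ^ toℕ j
    dˡ = det (minor A (inject₁ j))
    dʳ = det (minor A (suc j))

    collect : ∀ σ a b c d → a * (σ * c) - b * (-1ℤ * σ * d) ≡ σ * (a * c + b * d)
    collect = solve-∀

    M : Matrix (suc m) (suc m)
    M i l with l ≟ j
    ... | yes _ = v (suc j) * A (suc i) (suc j) + v (inject₁ j) * A (suc i) (inject₁ j)
    ... | no _ = A (suc i) (punchIn (suc j) l)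

    w : Fin (suc m) → ℤ
    w l with l ≟ j
    ... | yes _ = 1ℤ
    ... | no _ = v (punchIn (suc j) l)

    M-at : ∀ i → M i j ≡ v (suc j) * A (suc i) (suc j) + v (inject₁ j) * A (suc i) (inject₁ j)
    M-at i with j ≟ j
    ... | yes _ = refl
    ... | no j≢j = contradiction refl j≢j

    M-off : ∀ i l → l ≢ j → M i l ≡ A (suc i) (punchIn (suc j) l)
    M-off i l l≢j with l ≟ j
    ... | yes l≡j = contradiction l≡j l≢j
    ... | no _ = refl

    w-at : w j ≡ 1ℤ
    w-at with j ≟ j
    ... | yes _ = refl
    ... | no j≢j = contradiction refl j≢j

    w-off : ∀ l → l ≢ j → w l ≡ v (punchIn (suc j) l)
    w-off l l≢j with l ≟ j
    ... | yes l≡j = contradiction l≡j l≢j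
    ... | no _ = refl

    M-merged : ∀ i → M i j ≡ v (suc j) * minor A (inject₁ j) i j + v (inject₁ j) * minor A (suc j) i j
    M-merged i = trans (M-at i)
      (sym (cong₂ (λ a b → v (suc j) * A (suc i) a + v (inject₁ j) * A (suc i) b) (punchIn-inject₁ j) (punchIn-suc j)))

    M-left : ∀ i l → l ≢ j → minor A (inject₁ j) i l ≡ M i l
    M-left i l l≢j = trans (cong (A (suc i)) (punchIn-adjacent j l l≢j)) (sym (M-off i l l≢j))

    M-right : ∀ i l → l ≢ j → minor A (suc j) i l ≡ M i l
    M-right i l l≢j = sym (M-off i l l≢j)

    w≉0 : ∀ l → w l ≉ 0ℤ
    w≉0 l with l ≟ j
    ... | yes _ = 1≉0
    ... | no _ = v≉0 (punchIn (suc j) l)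

    split : ∀ a b c d r → (a * b + c * d) * 1ℤ + r ≡ b * a + (d * c + r)
    split = solve-∀

    Mw≈0 : ∀ i → sum (λ l → M i l * w l) ≈ 0ℤ
    Mw≈0 i = begin
      sum (λ l → M i l * w l)
        ≡⟨ sum-remove {i = j} (λ l → M i l * w l) ⟩
      M i j * w j + sum (λ l → M i (punchIn j l) * w (punchIn j l))
        ≡⟨ cong₂ _+_ (cong₂ _*_ (M-at i) w-at)
             (sum-cong-≗ λ l → cong₂ _*_ (M-off i (punchIn j l) (punchInᵢ≢i j l)) (w-off (punchIn j l) (punchInᵢ≢i j l))) ⟩
      (v (suc j) * row (suc j) + v (inject₁ j) * row (inject₁ j)) * 1ℤ + rest
        ≡⟨ split (v (suc j)) (row (suc j)) (v (inject₁ j)) (row (inject₁ j)) rest ⟩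
      row (suc j) * v (suc j) + (row (inject₁ j) * v (inject₁ j) + rest)
        -- Read upwards from `sum term`: column `j + 1` is split off first, then column `j`, which
        -- has position `j` among the remaining ones.
        ≡⟨ cong (λ l → row (suc j) * v (suc j) + (row l * v l + rest)) (punchIn-suc j) ⟨
      row (suc j) * v (suc j) + (term (punchIn (suc j) j) + rest)
        ≡⟨ cong (λ r → row (suc j) * v (suc j) + r) (sum-remove {i = j} (term ∘ punchIn (suc j))) ⟨
      row (suc j) * v (suc j) + sum (term ∘ punchIn (suc j))
        ≡⟨ sum-remove {i = suc j} term ⟨
      sum term
        ≈⟨ Av≈0 (suc i) ⟩
      0ℤ ∎
      where
      row = A (suc i)
      term = λ l → row l * v l
      rest = sum (λ l → term (punchIn (suc j) (punchIn j l)))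

  -- All rows but the first are annihilated by v, so they already determine their maximal minors up to a factor.
  cofactor-proportional : ∀ {m} (A : Matrix (suc m) (suc m)) (v : Fin (suc m) → ℤ) → (∀ j → v j ≉ 0ℤ) →
    (∀ i → sum (λ j → A i j * v j) ≈ 0ℤ) → ∀ j →
    v zero * cofactor A j ≈ v j * cofactor A zero
  cofactor-proportional A v v≉0 Av≈0 = <-weakInduction _ ≈-refl step
    where
    open ≈-Reasoning
    swap : ∀ a b c → a * (b * c) ≡ b * (a * c)
    swap = solve-∀
    step : ∀ j → v zero * cofactor A (inject₁ j) ≈ v (inject₁ j) * cofactor A zero →
           v zero * cofactor A (suc j) ≈ v (suc j) * cofactor A zero
    step j ih = *-cancelˡ _ _ (v≉0 (inject₁ j)) (begin
      v (inject₁ j) * (v zero * cofactor A (suc j))  ≡⟨ swap (v (inject₁ j)) (v zero) _ ⟩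
      v zero * (v (inject₁ j) * cofactor A (suc j))  ≈⟨ *-congˡ (v zero) (cofactor-adjacent A v v≉0 Av≈0 j) ⟨
      v zero * (v (suc j) * cofactor A (inject₁ j))  ≡⟨ swap (v zero) (v (suc j)) _ ⟩
      v (suc j) * (v zero * cofactor A (inject₁ j))  ≈⟨ *-congˡ (v (suc j)) ih ⟩
      v (suc j) * (v (inject₁ j) * cofactor A zero)  ≡⟨ swap (v (suc j)) (v (inject₁ j)) _ ⟩
      v (inject₁ j) * (v (suc j) * cofactor A zero)  ∎)

  det-singular A v v≉0 Av≈0 = *-cancelˡ-0 (det A) (v≉0 zero) (begin
    v zero * det A
      ≡⟨ *-distribˡ-sum (v zero) (λ j → -1ℤ ^ toℕ j * A zero j * det (minor A j)) ⟩
    sum (λ j → v zero * (-1ℤ ^ toℕ j * A zero j * det (minor A j)))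
      ≡⟨ sum-cong-≗ (λ j → regroup (v zero) (-1ℤ ^ toℕ j) (A zero j) (det (minor A j))) ⟩
    sum (λ j → A zero j * (v zero * cofactor A j))
      ≈⟨ sum-cong (λ j → *-congˡ (A zero j) (cofactor-proportional A v v≉0 Av≈0 j)) ⟩
    sum (λ j → A zero j * (v j * cofactor A zero))
      ≡⟨ sum-cong-≗ (λ j → assoc (A zero j) (v j) (cofactor A zero)) ⟩
    sum (λ j → A zero j * v j * cofactor A zero)
      ≡⟨ *-distribʳ-sum (cofactor A zero) (λ j → A zero j * v j) ⟨
    sum (λ j → A zero j * v j) * cofactor A zero
      ≈⟨ *-zeroˡ (cofactor A zero) (Av≈0 zero) ⟩
    0ℤ ∎)
    where
    open ≈-Reasoning
    regroup : ∀ a s b d → a * (s * b * d) ≡ b * (a * (s * d))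
    regroup = solve-∀
    assoc : ∀ a b c → a * (b * c) ≡ a * b * c
    assoc = solve-∀

  -- Residues, their permutations, and reindexing of sums and products.

  residue : ∀ x → ∃ λ (i : Fin p) → + toℕ i ≈ x
  residue x = fromℕ< (n%ℕd<d x p) , subst (λ r → + r ≈ x) (sym (toℕ-fromℕ< (n%ℕd<d x p)))
    (≈-sym (mod (divides (x /ℕ p) (begin
      x - + (x %ℕ p)                                  ≡⟨ cong (λ y → y - + (x %ℕ p)) (a≡a%ℕn+[a/ℕn]*n x p) ⟩
      + (x %ℕ p) + (x /ℕ p) * + p - + (x %ℕ p)        ≡⟨ drop (+ (x %ℕ p)) ((x /ℕ p) * + p) ⟩
      (x /ℕ p) * + p                                  ∎))))
    where
    open ≡-Reasoning
    drop : ∀ r s → r + s - r ≡ s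
    drop = solve-∀

  distinct-residues : ∀ {a b} → a < b → b < p → + b ≉ + a
  distinct-residues {a} {b} a<b b<p b≈a = ℕ.<⇒≱ (ℕ.≤-<-trans (ℕ.m∸n≤m b a) b<p)
    (ℕ.∣⇒≤ ⦃ ℕ.>-nonZero (ℕ.m<n⇒0<n∸m a<b) ⦄ (≈0⇒p∣ (begin
      + (b ℕ.∸ a)              ≡⟨ add-sub (+ (b ℕ.∸ a)) (+ a) ⟩
      + (b ℕ.∸ a) + + a - + a  ≡⟨ cong (λ c → + c - + a) (ℕ.m∸n+n≡m (ℕ.<⇒≤ a<b)) ⟩
      + b - + a                ≈⟨ zero-difference b≈a ⟩
      0ℤ                       ∎)))
    where
    open ≈-Reasoning
    add-sub : ∀ c a → c ≡ c + a - a
    add-sub = solve-∀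

  toℕ-injective-mod : ∀ (i j : Fin p) → + toℕ i ≈ + toℕ j → i ≡ j
  toℕ-injective-mod i j i≈j with ℕ.<-cmp (toℕ i) (toℕ j)
  ... | tri< i<j _ _ = contradiction (≈-sym i≈j) (distinct-residues i<j (toℕ<n j))
  ... | tri≈ _ i≡j _ = toℕ-injective i≡j
  ... | tri> _ _ j<i = contradiction i≈j (distinct-residues j<i (toℕ<n i))

  -- A permutation of the residue classes given by integer functions, so that formulas such as
  -- `λ t → -1ℤ * inv t` serve without reduction to representatives.
  record Bijection : Set where
    field
      to from : ℤ → ℤ
      to-cong : ∀ {x y} → x ≈ y → to x ≈ to y
      from-cong : ∀ {x y} → x ≈ y → from x ≈ from y
      to-from : ∀ x → to (from x) ≈ x
      from-to : ∀ x → from (to x) ≈ x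

  module _ (g : Bijection) where
    open Bijection g

    residue-permutation : Permutation p p
    residue-permutation = permutation (λ i → proj₁ (residue (to (+ toℕ i)))) (λ i → proj₁ (residue (from (+ toℕ i))))
      (λ i → toℕ-injective-mod _ i (≈-trans (proj₂ (residue _)) (≈-trans (to-cong (proj₂ (residue _))) (to-from (+ toℕ i)))))
      (λ i → toℕ-injective-mod _ i (≈-trans (proj₂ (residue _)) (≈-trans (from-cong (proj₂ (residue _))) (from-to (+ toℕ i)))))

    residue-permutation-≈ : ∀ i → + toℕ (residue-permutation ⟨$⟩ʳ i) ≈ to (+ toℕ i)
    residue-permutation-≈ i = proj₂ (residue (to (+ toℕ i)))

  Congruent : (ℤ → ℤ) → Set
  Congruent F = ∀ {x y} → x ≈ y → F x ≈ F y

  Σₚ : (ℤ → ℤ) → ℤ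
  Σₚ F = sum {p} (λ j → F (+ toℕ j))

  Πₚ : (ℤ → ℤ) → ℤ
  Πₚ F = product {p} (λ j → F (+ toℕ j))

  Σₚ-reindex : ∀ {F} → Congruent F → (g : Bijection) → Σₚ F ≈ Σₚ (F ∘ Bijection.to g)
  Σₚ-reindex {F} F-cong g = ≈-trans
    (≈-reflexive (sum-permute (λ j → F (+ toℕ j)) (residue-permutation g)))
    (sum-cong λ i → F-cong (residue-permutation-≈ g i))

  Πₚ-reindex : ∀ {F} → Congruent F → (g : Bijection) → Πₚ F ≈ Πₚ (F ∘ Bijection.to g)
  Πₚ-reindex {F} F-cong g = ≈-trans
    (≈-reflexive (product-permute (λ j → F (+ toℕ j)) (residue-permutation g)))
    (product-cong λ i → F-cong (residue-permutation-≈ g i))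

  -- Bézout for `p` and the representative of `x`. The inverse as a power of `x` comes only with
  -- `fermat`, which itself relies on the affine bijections built from this inverse.
  inverse-exists : ∀ x → x ≉ 0ℤ → ∃ λ y → y * x ≈ 1ℤ
  inverse-exists x x≉0 with residue x
  ... | zero , 0≈x = contradiction (≈-sym 0≈x) x≉0
  ... | i@(suc _) , i≈x with coprime-Bézout (prime⇒coprime p-prime (toℕ<n i))
  ...   | GCD.Bézout.+- a b 1+bi≡ap = - (+ b) , ≈-trans (*-congˡ (- (+ b)) (≈-sym i≈x))
    (≈-sym (mod (divides (+ a) (begin
      1ℤ - (- (+ b) * + toℕ i)   ≡⟨ unfold (+ b) (+ toℕ i) ⟩
      1ℤ + + b * + toℕ i         ≡⟨ cong (λ z → 1ℤ + z) (pos-* b (toℕ i)) ⟨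
      + (1 ℕ.+ b ℕ.* toℕ i)      ≡⟨ cong +_ 1+bi≡ap ⟩
      + (a ℕ.* p)                ≡⟨ pos-* a p ⟩
      + a * + p                  ∎))))
    where
    open ≡-Reasoning
    unfold : ∀ b i → 1ℤ - (- b * i) ≡ 1ℤ + b * i
    unfold = solve-∀
  ...   | GCD.Bézout.-+ a b 1+ap≡bi = + b , ≈-trans (*-congˡ (+ b) (≈-sym i≈x))
    (mod (divides (+ a) (begin
      + b * + toℕ i - 1ℤ         ≡⟨ cong (λ z → z - 1ℤ) (pos-* b (toℕ i)) ⟨
      + (b ℕ.* toℕ i) - 1ℤ       ≡⟨ cong (λ c → + c - 1ℤ) 1+ap≡bi ⟨
      1ℤ + + (a ℕ.* p) - 1ℤ      ≡⟨ drop (+ (a ℕ.* p)) ⟩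
      + (a ℕ.* p)                ≡⟨ pos-* a p ⟩
      + a * + p                  ∎)))
    where
    open ≡-Reasoning
    drop : ∀ c → 1ℤ + c - 1ℤ ≡ c
    drop = solve-∀

  affine : ∀ a b → a ≉ 0ℤ → Bijection
  affine a b a≉0 = record
    { to = λ x → a * x + b ; from = λ y → a⁻¹ * (y - b)
    ; to-cong = λ x≈y → +-cong (*-congˡ a x≈y) ≈-refl
    ; from-cong = λ x≈y → *-congˡ a⁻¹ (+-cong x≈y ≈-refl)
    ; to-from = λ y → modulo (y - b) a⁻¹a≈1 (to-from a⁻¹ a b y)
    ; from-to = λ x → modulo x a⁻¹a≈1 (from-to a⁻¹ a b x)
    }
    where
    a⁻¹ = proj₁ (inverse-exists a a≉0)
    a⁻¹a≈1 = proj₂ (inverse-exists a a≉0)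
    to-from : ∀ a⁻¹ a b y → a * (a⁻¹ * (y - b)) + b ≡ y + (y - b) * (a⁻¹ * a - 1ℤ)
    to-from = solve-∀
    from-to : ∀ a⁻¹ a b x → a⁻¹ * (a * x + b - b) ≡ x + x * (a⁻¹ * a - 1ℤ)
    from-to = solve-∀

  -- Fermat's little theorem and inverses as powers.

  product-scale : ∀ {m} x {f g : Fin m → ℤ} → (∀ i → f i ≈ x * g i) → product f ≈ x ^ m * product g
  product-scale {zero} x f≈xg = ≈-refl
  product-scale {suc m} x {f} {g} f≈xg = ≈-trans
    (*-cong (f≈xg zero) (product-scale x (f≈xg ∘ suc)))
    (≈-reflexive (interchange x (g zero) (x ^ m) (product (g ∘ suc))))
    where
    interchange : ∀ a b c d → a * b * (c * d) ≡ a * c * (b * d)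
    interchange = solve-∀

  -- Removes the residue 0 from products over all residues.
  nonzero-or-1 : ℤ → ℤ
  nonzero-or-1 x with x ≈? 0ℤ
  ... | yes _ = 1ℤ
  ... | no _ = x

  nonzero-or-1-zero : ∀ {x} → x ≈ 0ℤ → nonzero-or-1 x ≡ 1ℤ
  nonzero-or-1-zero {x} x≈0 with x ≈? 0ℤ
  ... | yes _ = refl
  ... | no x≉0 = contradiction x≈0 x≉0

  nonzero-or-1-nonzero : ∀ {x} → x ≉ 0ℤ → nonzero-or-1 x ≡ x
  nonzero-or-1-nonzero {x} x≉0 with x ≈? 0ℤ
  ... | yes x≈0 = contradiction x≈0 x≉0
  ... | no _ = refl

  nonzero-or-1-cong : Congruent nonzero-or-1
  nonzero-or-1-cong {x} {y} x≈y with x ≈? 0ℤ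
  ... | yes x≈0 = ≈-reflexive (sym (nonzero-or-1-zero (≈-trans (≈-sym x≈y) x≈0)))
  ... | no x≉0 = ≈-trans x≈y (≈-reflexive (sym (nonzero-or-1-nonzero (λ y≈0 → x≉0 (≈-trans x≈y y≈0)))))

  index≉0 : ∀ (i : Fin (suc n)) → index i ≉ 0ℤ
  index≉0 i = positive≉0 (toℕ i) (s<s (toℕ<n i))

  -- Multiplication by `x` permutes the nonzero residues, so their product `W` equals
  -- `x ^ (p - 1) * W`, and `W` cancels.
  fermat : ∀ x → x ≉ 0ℤ → x ^ suc n ≈ 1ℤ
  fermat x x≉0 = ≈-sym (*-cancelˡ 1ℤ (x ^ suc n) W≉0 (begin
    W * 1ℤ                            ≡⟨ W*1≡1*W W ⟩
    1ℤ * W                            ≡⟨ cong (_* W) (nonzero-or-1-zero ≈-refl) ⟨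
    Πₚ nonzero-or-1                   ≈⟨ Πₚ-reindex nonzero-or-1-cong (affine x 0ℤ x≉0) ⟩
    Πₚ (λ y → nonzero-or-1 (x * y + 0ℤ))
      -- The residue 0 contributes the factor 1; each of the other `p - 1` factors releases one `x`.
      ≈⟨ *-cong (≈-reflexive (nonzero-or-1-zero (≈-reflexive (x*0+0≡0 x))))
           (product-scale x λ i → ≈-reflexive (trans (cong nonzero-or-1 (+-identityʳ (x * index i))) (trans
             (nonzero-or-1-nonzero (*-nonzero x≉0 (index≉0 i)))
             (cong (x *_) (sym (nonzero-or-1-nonzero (index≉0 i))))))) ⟩
    1ℤ * (x ^ suc n * W)              ≡⟨ 1*[u*W]≡W*u (x ^ suc n) W ⟩
    W * x ^ suc n                     ∎))
    where
    open ≈-Reasoning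
    W : ℤ
    W = product (λ (i : Fin (suc n)) → nonzero-or-1 (index i))
    W≉0 : W ≉ 0ℤ
    W≉0 = product-nonzero λ i → subst (_≉ 0ℤ) (sym (nonzero-or-1-nonzero (index≉0 i))) (index≉0 i)
    x*0+0≡0 : ∀ x → x * 0ℤ + 0ℤ ≡ 0ℤ
    x*0+0≡0 = solve-∀
    W*1≡1*W : ∀ w → w * 1ℤ ≡ 1ℤ * w
    W*1≡1*W = solve-∀
    1*[u*W]≡W*u : ∀ u w → 1ℤ * (u * w) ≡ w * u
    1*[u*W]≡W*u = solve-∀

  -- The exponent `n` is `p - 2`. Since `x ^ suc n` unfolds to `x * inv x`, `fermat` is directly the
  -- law of inverses.
  inv : ℤ → ℤ
  inv x = x ^ n

  inv-cong : Congruent inv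
  inv-cong = ^-cong n

  ^-zero : ∀ {k x} → 0 < k → x ≈ 0ℤ → x ^ k ≈ 0ℤ
  ^-zero {suc k} {x} _ x≈0 = *-zeroˡ (x ^ k) x≈0

  inv-zero : ∀ {x} → x ≈ 0ℤ → inv x ≈ 0ℤ
  -- `p > 3` strips down to `1 < n`, so the exponent is positive.
  inv-zero = ^-zero (ℕ.<-trans z<s (ℕ.s<s⁻¹ (ℕ.s<s⁻¹ p>3)))

  inv-unique : ∀ {x} y → x * y ≈ 1ℤ → inv x ≈ y
  inv-unique {x} y xy≈1 = *-cancelˡ (inv x) y x≉0 (≈-trans (fermat x x≉0) (≈-sym xy≈1))
    where
    x≉0 : x ≉ 0ℤ
    x≉0 x≈0 = 1≉0 (≈-trans (≈-sym xy≈1) (*-zeroˡ y x≈0))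

  inv-neg : ∀ x → inv (- x) ≈ - inv x
  inv-neg x with x ≈? 0ℤ
  ... | yes x≈0 = ≈-trans (inv-zero (neg-cong x≈0)) (≈-sym (neg-cong (inv-zero x≈0)))
  ... | no x≉0 = inv-unique (- inv x) (≈-trans (≈-reflexive (neg*neg x (inv x))) (fermat x x≉0))
    where
    neg*neg : ∀ x y → - x * - y ≡ x * y
    neg*neg = solve-∀

  inv-involutive : ∀ x → inv (inv x) ≈ x
  inv-involutive x with x ≈? 0ℤ
  ... | yes x≈0 = ≈-trans (inv-zero (inv-zero x≈0)) (≈-sym x≈0)
  ... | no x≉0 = inv-unique x (≈-trans (≈-reflexive (comm (inv x) x)) (fermat x x≉0))
    where
    comm : ∀ x y → x * y ≡ y * x
    comm = solve-∀

  -1≉0 : -1ℤ ≉ 0ℤ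
  -1≉0 -1≈0 = 1≉0 (neg-cong -1≈0)

  2≉0 : + 2 ≉ 0ℤ
  2≉0 = positive≉0 1 (ℕ.<-trans (s<s (s<s z<s)) p>3)

  3≉0 : + 3 ≉ 0ℤ
  3≉0 = positive≉0 2 p>3

  -- Sums over all residues.

  Σₚ-cong : ∀ {F G} → (∀ x → F x ≈ G x) → Σₚ F ≈ Σₚ G
  Σₚ-cong F≈G = sum-cong {p} λ i → F≈G (+ toℕ i)

  Σₚ-+ : ∀ F G → Σₚ (λ x → F x + G x) ≡ Σₚ F + Σₚ G
  Σₚ-+ F G = ∑-distrib-+ {p} (λ i → F (+ toℕ i)) (λ i → G (+ toℕ i))

  Σₚ-* : ∀ c F → Σₚ (λ x → c * F x) ≡ c * Σₚ F
  Σₚ-* c F = sym (*-distribˡ-sum {p} c (λ i → F (+ toℕ i)))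

  Σₚ-1 : Σₚ (λ _ → 1ℤ) ≈ 0ℤ
  Σₚ-1 = ≈-trans (≈-reflexive (sum-1 p)) (p∣⇒≈0 ℕ.∣-refl)
    where
    sum-1 : ∀ m → sum {m} (λ _ → 1ℤ) ≡ + m
    sum-1 zero = refl
    sum-1 (suc m) = cong (λ s → 1ℤ + s) (sum-1 m)

  -- Reindexing by `g` shows that the sum equals its own negative, and 2 is invertible modulo `p`.
  Σₚ-antisymmetric : ∀ {F} → Congruent F → (g : Bijection) → (∀ x → F (Bijection.to g x) ≈ -1ℤ * F x) → Σₚ F ≈ 0ℤ
  Σₚ-antisymmetric {F} F-cong g Fg≈-F = *-cancelˡ-0 (Σₚ F) 2≉0 (modulo 1ℤ Σ≈-Σ (double (Σₚ F)))
    where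
    Σ≈-Σ : Σₚ F ≈ -1ℤ * Σₚ F
    Σ≈-Σ = ≈-trans (Σₚ-reindex F-cong g) (≈-trans (Σₚ-cong Fg≈-F) (≈-reflexive (Σₚ-* -1ℤ F)))
    double : ∀ x → + 2 * x ≡ 0ℤ + 1ℤ * (x - -1ℤ * x)
    double = solve-∀

  Σₚ-inv : Σₚ inv ≈ 0ℤ
  Σₚ-inv = Σₚ-antisymmetric inv-cong (affine -1ℤ 0ℤ -1≉0) λ x →
    ≈-trans (≈-reflexive (cong inv (lhs x))) (≈-trans (inv-neg x) (≈-reflexive (rhs (inv x))))
    where
    lhs : ∀ x → -1ℤ * x + 0ℤ ≡ - x
    lhs = solve-∀
    rhs : ∀ x → - x ≡ -1ℤ * x
    rhs = solve-∀

  Σₚ-inv-affine : ∀ a b → a ≉ 0ℤ → Σₚ (λ t → inv (a * t + b)) ≈ 0ℤ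
  Σₚ-inv-affine a b a≉0 = ≈-trans (≈-sym (Σₚ-reindex inv-cong (affine a b a≉0))) Σₚ-inv

  -- Reduction of the determinant to a single sum.

  -- The form `x² + c x y + d y²` of the matrix entries, dehomogenized at `x = 1`, `y = t`.
  quadratic : ℤ → ℤ → ℤ → ℤ
  quadratic c d t = 1ℤ + c * t + d * t ^ 2

  summand : ℤ → ℤ → ℕ → ℤ → ℤ
  summand c d k t = inv (quadratic c d t) * t ^ k

  quadratic-cong : ∀ c d → Congruent (quadratic c d)
  quadratic-cong c d x≈y = +-cong (+-cong (≈-refl {1ℤ}) (*-congˡ c x≈y)) (*-congˡ d (^-cong 2 x≈y))

  summand-cong : ∀ c d k → Congruent (summand c d k)
  summand-cong c d k x≈y = *-cong (inv-cong (quadratic-cong c d x≈y)) (^-cong k x≈y)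

  summand-zero : ∀ c d {k t} → 0 < k → t ≈ 0ℤ → summand c d k t ≈ 0ℤ
  summand-zero c d {k} {t} 0<k t≈0 = *-zeroʳ (inv (quadratic c d t)) (^-zero 0<k t≈0)

  -- After the substitution j = i t, the vector with entries j ^ k is an
  -- eigenvector up to powers of i, with this sum as the eigenvalue.
  D-vanishes : ∀ c d {k} → 0 < k → Σₚ (summand c d k) ≈ 0ℤ → D p c d ≡ 0ℤ [mod p ]
  D-vanishes c d {k} 0<k Σ≈0 = congruent {D p c d} {0ℤ} (det-singular {n} (λ i j → form (index i) (index j) ^ n)
    (λ j → index j ^ k) (λ j → ^-nonzero k (index≉0 j)) λ i → row (index i) (index≉0 i))
    where
    open ≈-Reasoning
    form : ℤ → ℤ → ℤ
    form x y = x ^ 2 + c * x * y + d * y ^ 2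

    -- Squares appear as `y * (y * 1ℤ)`, the unfolding of `y ^ 2`, to agree definitionally with
    -- `form` and `quadratic`.
    homogeneous : ∀ c d x t → x * (x * 1ℤ) + c * x * (x * t + 0ℤ) + d * ((x * t + 0ℤ) * ((x * t + 0ℤ) * 1ℤ)) ≡
      x * x * (1ℤ + c * t + d * (t * (t * 1ℤ)))
    homogeneous = solve-∀

    interchange : ∀ a b c d → a * b * (c * d) ≡ a * c * (b * d)
    interchange = solve-∀

    form-cong : ∀ x → Congruent (form x)
    form-cong x y≈z = +-cong (+-cong (≈-refl {x ^ 2}) (*-congˡ (c * x) y≈z)) (*-congˡ d (^-cong 2 y≈z))

    rescale : ∀ x t → inv (form x (x * t + 0ℤ)) * (x * t + 0ℤ) ^ k ≈ inv (x * x) * x ^ k * summand c d k t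
    rescale x t = begin
      inv (form x (x * t + 0ℤ)) * (x * t + 0ℤ) ^ k
        ≡⟨ cong₂ (λ a b → inv a * b ^ k) (homogeneous c d x t) (+-identityʳ (x * t)) ⟩
      inv (x * x * quadratic c d t) * (x * t) ^ k
        ≡⟨ cong₂ _*_ (^-distribʳ-* (x * x) (quadratic c d t) n) (^-distribʳ-* x t k) ⟩
      inv (x * x) * inv (quadratic c d t) * (x ^ k * t ^ k)
        ≡⟨ interchange (inv (x * x)) (inv (quadratic c d t)) (x ^ k) (t ^ k) ⟩
      inv (x * x) * x ^ k * summand c d k t ∎

    0+x≡x : ∀ x → 0ℤ + x ≡ x
    0+x≡x = solve-∀

    row : ∀ x → x ≉ 0ℤ → sum (λ (j : Fin (suc n)) → form x (index j) ^ n * index j ^ k) ≈ 0ℤ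
    row x x≉0 = begin
      S                                                  ≡⟨ 0+x≡x S ⟨
      -- The indices of the matrix start at 1; the missing term at the residue 0 vanishes because
      -- `k > 0`.
      0ℤ + S                                             ≈⟨ +-cong (*-zeroʳ (inv (form x 0ℤ)) (^-zero 0<k (≈-refl {0ℤ}))) (≈-refl {S}) ⟨
      Σₚ F                                               ≈⟨ Σₚ-reindex F-cong (affine x 0ℤ x≉0) ⟩
      Σₚ (λ t → F (x * t + 0ℤ))                          ≈⟨ Σₚ-cong (rescale x) ⟩
      Σₚ (λ t → inv (x * x) * x ^ k * summand c d k t)   ≡⟨ Σₚ-* (inv (x * x) * x ^ k) (summand c d k) ⟩
      inv (x * x) * x ^ k * Σₚ (summand c d k)           ≈⟨ *-zeroʳ (inv (x * x) * x ^ k) Σ≈0 ⟩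
      0ℤ                                                 ∎
      where
      S = sum (λ (j : Fin (suc n)) → form x (index j) ^ n * index j ^ k)
      F : ℤ → ℤ
      F y = inv (form x y) * y ^ k
      F-cong : Congruent F
      F-cong y≈z = *-cong (inv-cong (form-cong x y≈z)) (^-cong k y≈z)

  -- Roots of polynomials modulo `p`.

  -- Coefficients are listed from the constant term upwards; the leading coefficient 1 is implicit,
  -- so the length of the vector is the degree.
  evalMonic : ∀ {m} → Vec ℤ m → ℤ → ℤ
  evalMonic [] x = 1ℤ
  evalMonic (a ∷ as) x = a + x * evalMonic as x

  -- Synthetic division by `x - r`: the constant term of the quotient is the value at `r` of the
  -- polynomial given by the remaining coefficients.
  factor-theorem : ∀ {m} (as : Vec ℤ (suc m)) r →
    ∃ λ (qs : Vec ℤ m) → ∀ x → evalMonic as x - evalMonic as r ≡ (x - r) * evalMonic qs x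
  factor-theorem (a ∷ []) r = [] , λ x → linear a x r
    where
    linear : ∀ a x r → a + x * 1ℤ - (a + r * 1ℤ) ≡ (x - r) * 1ℤ
    linear = solve-∀
  factor-theorem (a ∷ as@(_ ∷ _)) r with factor-theorem as r
  ... | qs , as≡ = evalMonic as r ∷ qs , λ x → begin
    a + x * evalMonic as x - (a + r * evalMonic as r)
      ≡⟨ expand a x r (evalMonic as x) (evalMonic as r) ⟩
    (x - r) * evalMonic as r + x * (evalMonic as x - evalMonic as r)
      ≡⟨ cong (λ d → (x - r) * evalMonic as r + x * d) (as≡ x) ⟩
    (x - r) * evalMonic as r + x * ((x - r) * evalMonic qs x)
      ≡⟨ collect x r (evalMonic as r) (evalMonic qs x) ⟩
    (x - r) * (evalMonic as r + x * evalMonic qs x) ∎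
    where
    open ≡-Reasoning
    expand : ∀ a x r u v → a + x * u - (a + r * v) ≡ (x - r) * v + x * (u - v)
    expand = solve-∀
    collect : ∀ x r v w → (x - r) * v + x * ((x - r) * w) ≡ (x - r) * (v + x * w)
    collect = solve-∀

  -- Lagrange's bound: dividing out the first root keeps the others as roots, since differences of
  -- distinct roots cancel, and in degree 0 only the constant 1 is left.
  too-many-roots : ∀ {m} (as : Vec ℤ m) (r : Fin (suc m) → ℤ) →
    (∀ i j → i ≢ j → r i ≉ r j) → ¬ (∀ i → evalMonic as (r i) ≈ 0ℤ)
  too-many-roots [] r distinct roots = 1≉0 (roots zero)
  too-many-roots as@(_ ∷ _) r distinct roots with factor-theorem as (r zero)
  ... | qs , as≡ = too-many-roots qs (r ∘ suc) (λ i j i≢j → distinct (suc i) (suc j) (i≢j ∘ suc-injective)) λ i →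
    *-cancelˡ-0 {r (suc i) - r zero} (evalMonic qs (r (suc i)))
      (λ d≈0 → distinct (suc i) zero (λ ()) (difference-zero {r (suc i)} d≈0))
      (≈-trans (≈-reflexive (sym (as≡ (r (suc i)))))
        (zero-difference {evalMonic as (r (suc i))} (≈-trans (roots (suc i)) (≈-sym (roots zero)))))

  -- Otherwise `X ^ k - 1` would have more than `k` roots among the nonzero residues. This does the
  -- work of a primitive root in producing elements of order 3 and 4.
  power≉1 : ∀ k → 0 < k → k < suc n → ∃ λ x → x ≉ 0ℤ × x ^ k ≉ 1ℤ
  power≉1 (suc k) _ k<n with any? (λ (i : Fin (suc n)) → ¬? (index i ^ suc k ≈? 1ℤ))
  ... | yes (i , i^k≉1) = index i , index≉0 i , i^k≉1
  ... | no none = contradiction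
    (λ i → ≈-trans (≈-reflexive (eval-X^k-1 (r i)))
      (zero-difference {r i ^ suc k} (decidable-stable (r i ^ suc k ≈? 1ℤ) λ i^k≉1 → none (inject≤ i k<n , i^k≉1))))
    (too-many-roots (-1ℤ ∷ replicate k 0ℤ) r λ i j i≢j ri≈rj →
      i≢j (inject≤-injective k<n k<n i j
        (suc-injective (toℕ-injective-mod (suc (inject≤ i k<n)) (suc (inject≤ j k<n)) ri≈rj))))
    where
    r : Fin (suc (suc k)) → ℤ
    r i = index (inject≤ i k<n)
    eval-X^k : ∀ k x → evalMonic (replicate k 0ℤ) x ≡ x ^ k
    eval-X^k zero x = refl
    eval-X^k (suc k) x = trans (0+x≡x (x * evalMonic (replicate k 0ℤ) x)) (cong (x *_) (eval-X^k k x))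
      where
      0+x≡x : ∀ x → 0ℤ + x ≡ x
      0+x≡x = solve-∀
    eval-X^k-1 : ∀ x → evalMonic (-1ℤ ∷ replicate k 0ℤ) x ≡ x ^ suc k - 1ℤ
    eval-X^k-1 x = trans (cong (λ y → -1ℤ + x * y) (eval-X^k k x)) (swap (x * x ^ k))
      where
      swap : ∀ y → -1ℤ + y ≡ y - 1ℤ
      swap = solve-∀

  -- Square roots of 3.

  fermat² : ∀ x → x ^ (3 ℕ.+ n) ≈ x * x
  fermat² x with x ≈? 0ℤ
  ... | yes x≈0 = ≈-trans (*-zeroˡ (x ^ (2 ℕ.+ n)) x≈0) (≈-sym (*-zeroˡ x x≈0))
  ... | no x≉0 = modulo (x * x) (fermat x x≉0) (split x (x ^ suc n))
    where
    split : ∀ x y → x * (x * y) ≡ x * x + x * x * (y - 1ℤ)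
    split = solve-∀

  -- If `ω² + ω + 1 = 0`, then `(2 ω + 1)² = -3`; a factor `ι` with `ι² = -1` turns this into 3.
  sqrt3-p≡1 : ∀ q → suc n ≡ q ℕ.* 12 → ∃ λ s → s * s ≈ + 3
  sqrt3-p≡1 q n+1≡12q = s , ≈-trans
    (modulo ((+ 2 * ω + 1ℤ) * (+ 2 * ω + 1ℤ)) ι²≈-1 (expand-ι ι ω))
    (modulo (- (+ 4)) ω²+ω+1≈0 (expand-ω ω))
    where
    instance
      q≢0 : ℕ.NonZero q
      q≢0 = ℕ.≢-nonZero λ q≡0 → contradiction (trans n+1≡12q (cong (ℕ._* 12) q≡0)) λ ()
    nontrivial : ∀ k → 0 < k → k < 12 → ∃ λ x → x ≉ 0ℤ × x ^ (q ℕ.* k) ≉ 1ℤ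
    nontrivial k 0<k k<12 = power≉1 (q ℕ.* k)
      (subst (_< q ℕ.* k) (ℕ.*-zeroʳ q) (ℕ.*-monoʳ-< q 0<k))
      (subst (q ℕ.* k <_) (sym n+1≡12q) (ℕ.*-monoʳ-< q k<12))
    -- With `p - 1 = 12 q` the exponents of `η`, `ω`, `ι` are `(p - 1) / 2`, `(p - 1) / 3`,
    -- `(p - 1) / 4`. As `η² = 1` and `η` is not 1, `ι² = η = -1`; as `ω³ = 1` and `ω` is not 1,
    -- `ω² + ω + 1 = 0`.
    x = nontrivial 6 z<s (ℕ.m≤n+m 7 5)
    y = nontrivial 4 z<s (ℕ.m≤n+m 5 7)
    ω = proj₁ y ^ (q ℕ.* 4)
    η = proj₁ x ^ (q ℕ.* 6)
    ι = proj₁ x ^ (q ℕ.* 3)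
    s = ι * (+ 2 * ω + 1ℤ)

    order : ∀ z → z ≉ 0ℤ → ∀ j k → j ℕ.* k ≡ 12 → (z ^ (q ℕ.* j)) ^ k ≈ 1ℤ
    order z z≉0 j k jk≡12 = ≈-trans (≈-reflexive (trans (^-*-assoc z (q ℕ.* j) k) (cong (z ^_)
      (trans (ℕ.*-assoc q j k) (trans (cong (q ℕ.*_) jk≡12) (sym n+1≡12q)))))) (fermat z z≉0)

    factor₂ : ∀ u → (u - 1ℤ) * (u + 1ℤ) ≡ 0ℤ + 1ℤ * (u * (u * 1ℤ) - 1ℤ)
    factor₂ = solve-∀
    factor₃ : ∀ u → (u - 1ℤ) * (u * u + u + 1ℤ) ≡ 0ℤ + 1ℤ * (u * (u * (u * 1ℤ)) - 1ℤ)
    factor₃ = solve-∀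

    η+1≈0 : η + 1ℤ ≈ 0ℤ
    η+1≈0 = *-cancelˡ-0 {η - 1ℤ} (η + 1ℤ) (λ η-1≈0 → proj₂ (proj₂ x) (difference-zero {η} η-1≈0))
      (modulo {v = 1ℤ} 1ℤ (order (proj₁ x) (proj₁ (proj₂ x)) 6 2 refl) (factor₂ η))

    ω²+ω+1≈0 : ω * ω + ω + 1ℤ ≈ 0ℤ
    ω²+ω+1≈0 = *-cancelˡ-0 {ω - 1ℤ} (ω * ω + ω + 1ℤ) (λ ω-1≈0 → proj₂ (proj₂ y) (difference-zero {ω} ω-1≈0))
      (modulo {v = 1ℤ} 1ℤ (order (proj₁ y) (proj₁ (proj₂ y)) 4 3 refl) (factor₃ ω))

    ι²≈-1 : ι * ι ≈ -1ℤ
    ι²≈-1 = ≈-trans (≈-reflexive ι²≡η) (modulo 1ℤ η+1≈0 (η≡ η))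
      where
      square : ∀ u → u * u ≡ u * (u * 1ℤ)
      square = solve-∀
      ι²≡η : ι * ι ≡ η
      ι²≡η = trans (square ι) (trans (^-*-assoc (proj₁ x) (q ℕ.* 3) 2) (cong (proj₁ x ^_) (ℕ.*-assoc q 3 2)))
      η≡ : ∀ η → η ≡ -1ℤ + 1ℤ * (η + 1ℤ - 0ℤ)
      η≡ = solve-∀

    expand-ι : ∀ ι ω → ι * (+ 2 * ω + 1ℤ) * (ι * (+ 2 * ω + 1ℤ)) ≡
      -1ℤ * ((+ 2 * ω + 1ℤ) * (+ 2 * ω + 1ℤ)) + (+ 2 * ω + 1ℤ) * (+ 2 * ω + 1ℤ) * (ι * ι - -1ℤ)
    expand-ι = solve-∀
    expand-ω : ∀ ω → -1ℤ * ((+ 2 * ω + 1ℤ) * (+ 2 * ω + 1ℤ)) ≡ + 3 + - (+ 4) * (ω * ω + ω + 1ℤ - 0ℤ)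
    expand-ω = solve-∀

  -- If y² = - 3 then (y - 1)³ = 8, so that y - 1 is twice a cube root of unity.
  -- As p ≡ 2 modulo 3, it is 2 itself, which is absurd.
  -3-nonsquare : ∀ q → 3 ℕ.+ n ≡ 3 ℕ.* q → ∀ y → y * y ≉ - (+ 3)
  -3-nonsquare q n+3≡3q y y²≈-3 = *-nonzero (*-nonzero 2≉0 2≉0) 3≉0
    (≈-trans (modulo 1ℤ y²≈-3 (twelve y)) (modulo (- (y + + 3)) w≈2 (last y)))
    where
    open ≈-Reasoning
    w = y - 1ℤ
    cube : ∀ y → (y - 1ℤ) * ((y - 1ℤ) * ((y - 1ℤ) * 1ℤ)) ≡ + 8 + (y - + 3) * (y * y - - (+ 3))
    cube = solve-∀
    w³≈8 : w ^ 3 ≈ + 8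
    w³≈8 = modulo (y - + 3) y²≈-3 (cube y)
    -- Since 3 divides `p + 1`, the square `w² = w ^ (p + 1)` is a power of `w³ = 8`, and the same
    -- computation for 2 leads back to 4.
    w²≈4 : w * w ≈ + 4
    w²≈4 = begin
      w * w                   ≈⟨ fermat² w ⟨
      w ^ (3 ℕ.+ n)           ≡⟨ cong (w ^_) n+3≡3q ⟩
      w ^ (3 ℕ.* q)           ≡⟨ ^-*-assoc w 3 q ⟨
      (w ^ 3) ^ q             ≈⟨ ^-cong q w³≈8 ⟩
      ((+ 2) ^ 3) ^ q         ≡⟨ ^-*-assoc (+ 2) 3 q ⟩
      (+ 2) ^ (3 ℕ.* q)       ≡⟨ cong ((+ 2) ^_) n+3≡3q ⟨
      (+ 2) ^ (3 ℕ.+ n)       ≈⟨ fermat² (+ 2) ⟩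
      + 4                     ∎
    cube′ : ∀ w → + 4 * w ≡ w * (w * (w * 1ℤ)) + - w * (w * w - + 4)
    cube′ = solve-∀
    w≈2 : w ≈ + 2
    w≈2 = *-cancelˡ {+ 4} w (+ 2) (*-nonzero 2≉0 2≉0) (≈-trans (modulo (- w) w²≈4 (cube′ w)) w³≈8)
    -- From `w = 2` follows `y = 3` and `y² = 9`; against `y² = -3` this makes 12 vanish, contrary
    -- to `p > 3`.
    twelve : ∀ y → + 12 ≡ + 9 - y * y + 1ℤ * (y * y - - (+ 3))
    twelve = solve-∀
    last : ∀ y → + 9 - y * y ≡ 0ℤ + - (y + + 3) * (y - 1ℤ - + 2)
    last = solve-∀

  -- Here `e = 3 ^ ((p + 1) / 2)` satisfies `e² = 3 ^ (p + 1) = 9`, so `e` is 3 or -3, and `f² = e`.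
  -- The value -3 would make -3 a square.
  sqrt3-p≡-1 : ∀ q → 3 ℕ.+ n ≡ q ℕ.* 12 → ∃ λ s → s * s ≈ + 3
  sqrt3-p≡-1 q n+3≡12q = [ (λ e-3≈0 → f , ≈-trans (≈-reflexive f²≡e) (difference-zero {e} e-3≈0))
                         , (λ e+3≈0 → contradiction (≈-trans (≈-reflexive f²≡e) (modulo 1ℤ e+3≈0 (e≡ e)))
                             (-3-nonsquare (q ℕ.* 4) (trans n+3≡12q (trans (sym (ℕ.*-assoc q 4 3)) (ℕ.*-comm (q ℕ.* 4) 3))) f)) ]′
    (zero-product (e - + 3) (e + + 3) (modulo 1ℤ e²≈9 (factor e)))
    where
    e = (+ 3) ^ (q ℕ.* 6)
    f = (+ 3) ^ (q ℕ.* 3)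
    square : ∀ u → u * u ≡ u * (u * 1ℤ)
    square = solve-∀
    f²≡e : f * f ≡ e
    f²≡e = trans (square f) (trans (^-*-assoc (+ 3) (q ℕ.* 3) 2) (cong ((+ 3) ^_) (ℕ.*-assoc q 3 2)))
    e²≈9 : e * e ≈ + 9
    e²≈9 = ≈-trans (≈-reflexive (trans (square e) (trans (^-*-assoc (+ 3) (q ℕ.* 6) 2)
      (cong ((+ 3) ^_) (trans (ℕ.*-assoc q 6 2) (sym n+3≡12q)))))) (fermat² (+ 3))
    factor : ∀ e → (e - + 3) * (e + + 3) ≡ 0ℤ + 1ℤ * (e * e - + 9)
    factor = solve-∀
    e≡ : ∀ e → e ≡ - (+ 3) + 1ℤ * (e + + 3 - 0ℤ)
    e≡ = solve-∀

  -- The case `d = -1`.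

  ^-even : ∀ x r → x ^ (r ℕ.* 2) ≡ (x ^ 2) ^ r
  ^-even x r = trans (cong (x ^_) (ℕ.*-comm r 2)) (sym (^-*-assoc x 2 r))

  -1^even : ∀ r → -1ℤ ^ (r ℕ.* 2) ≡ 1ℤ
  -1^even r = trans (^-even -1ℤ r) (^-zeroˡ r)

  -- For even k with 2 k = p + 1 the substitution t ↦ - 1 / t changes the sign of the summand.
  Σ-summand-d≡-1 : ∀ c k → 0 < k → 3 ℕ.+ n ≡ k ℕ.* 2 → -1ℤ ^ k ≡ 1ℤ → Σₚ (summand c -1ℤ k) ≈ 0ℤ
  Σ-summand-d≡-1 c k 0<k n+3≡2k -1^k≡1 = Σₚ-antisymmetric (summand-cong c -1ℤ k) -1/t antisymmetric
    where
    open ≈-Reasoning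

    -1/-1/t≈t : ∀ t → -1ℤ * inv (-1ℤ * inv t) ≈ t
    -1/-1/t≈t t = begin
      -1ℤ * inv (-1ℤ * inv t)     ≡⟨ cong (λ u → -1ℤ * inv u) (-1*u≡-u (inv t)) ⟩
      -1ℤ * inv (- inv t)         ≈⟨ *-congˡ -1ℤ (inv-neg (inv t)) ⟩
      -1ℤ * - inv (inv t)         ≡⟨ -1*-u≡u (inv (inv t)) ⟩
      inv (inv t)                 ≈⟨ inv-involutive t ⟩
      t                           ∎
      where
      -1*u≡-u : ∀ u → -1ℤ * u ≡ - u
      -1*u≡-u = solve-∀
      -1*-u≡u : ∀ u → -1ℤ * - u ≡ u
      -1*-u≡u = solve-∀

    -1/t : Bijection
    -1/t = record
      { to = λ t → -1ℤ * inv t ; from = λ t → -1ℤ * inv t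
      ; to-cong = λ x≈y → *-congˡ -1ℤ (inv-cong x≈y) ; from-cong = λ x≈y → *-congˡ -1ℤ (inv-cong x≈y)
      ; to-from = -1/-1/t≈t ; from-to = -1/-1/t≈t }

    antisymmetric : ∀ t → summand c -1ℤ k (-1ℤ * inv t) ≈ -1ℤ * summand c -1ℤ k t
    antisymmetric t with t ≈? 0ℤ
    -- The bijection fixes 0 because `inv` does, and the summand vanishes there.
    ... | yes t≈0 = ≈-trans (summand-zero c -1ℤ 0<k (*-zeroʳ -1ℤ (inv-zero t≈0)))
      (≈-sym (*-zeroʳ -1ℤ (summand-zero c -1ℤ 0<k t≈0)))
    ... | no t≉0 = begin
      inv (quadratic c -1ℤ (-1ℤ * w)) * (-1ℤ * w) ^ k
        -- For `d = -1` the value of the quadratic at `-1 / t` is `-1 / t²` times its value at `t`;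
        -- the sign in the power disappears as `-1ℤ ^ k` is 1.
        ≈⟨ *-cong (inv-cong (modulo (- (1ℤ + t * w - c * w)) (fermat t t≉0) (reflect c t w)))
                  (≈-reflexive (trans (^-distribʳ-* -1ℤ w k) (cong (_* w ^ k) -1^k≡1))) ⟩
      inv (- (w * w) * quadratic c -1ℤ t) * (1ℤ * w ^ k)
        ≡⟨ cong (_* (1ℤ * w ^ k)) (^-distribʳ-* (- (w * w)) (quadratic c -1ℤ t) n) ⟩
      inv (- (w * w)) * inv (quadratic c -1ℤ t) * (1ℤ * w ^ k)
        ≈⟨ *-congʳ (1ℤ * w ^ k) (*-congʳ (inv (quadratic c -1ℤ t))
             (inv-unique (- (t * t)) (modulo (t * w + 1ℤ) (fermat t t≉0) (square t w)))) ⟩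
      - (t * t) * inv (quadratic c -1ℤ t) * (1ℤ * w ^ k)
        -- As `2 k = p + 1`, `t²` may be replaced by `t ^ k * t ^ k`; one of these factors then
        -- cancels `w ^ k`.
        ≈⟨ modulo (inv (quadratic c -1ℤ t) * w ^ k) t^k*t^k≈t*t (use-square t (inv (quadratic c -1ℤ t)) (w ^ k) (t ^ k)) ⟩
      -1ℤ * (inv (quadratic c -1ℤ t) * t ^ k) * (t ^ k * w ^ k)
        ≈⟨ *-congˡ (-1ℤ * summand c -1ℤ k t) t^k*w^k≈1 ⟩
      -1ℤ * summand c -1ℤ k t * 1ℤ
        ≡⟨ u*1≡u (-1ℤ * summand c -1ℤ k t) ⟩
      -1ℤ * summand c -1ℤ k t ∎
      where
      w = inv t

      t^k*t^k≈t*t : t ^ k * t ^ k ≈ t * t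
      t^k*t^k≈t*t = ≈-trans
        (≈-reflexive (trans (square′ (t ^ k)) (trans (^-*-assoc t k 2) (cong (t ^_) (sym n+3≡2k)))))
        (fermat² t)
        where
        square′ : ∀ u → u * u ≡ u * (u * 1ℤ)
        square′ = solve-∀

      t^k*w^k≈1 : t ^ k * w ^ k ≈ 1ℤ
      t^k*w^k≈1 = ≈-trans (≈-reflexive (sym (^-distribʳ-* t w k)))
        (≈-trans (^-cong k (fermat t t≉0)) (≈-reflexive (^-zeroˡ k)))

      reflect : ∀ c t w → 1ℤ + c * (-1ℤ * w) + -1ℤ * ((-1ℤ * w) * ((-1ℤ * w) * 1ℤ)) ≡
        - (w * w) * (1ℤ + c * t + -1ℤ * (t * (t * 1ℤ))) + - (1ℤ + t * w - c * w) * (t * w - 1ℤ)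
      reflect = solve-∀
      square : ∀ t w → - (w * w) * - (t * t) ≡ 1ℤ + (t * w + 1ℤ) * (t * w - 1ℤ)
      square = solve-∀
      use-square : ∀ t q v u → - (t * t) * q * (1ℤ * v) ≡ -1ℤ * (q * u) * (u * v) + q * v * (u * u - t * t)
      use-square = solve-∀
      u*1≡u : ∀ u → u * 1ℤ ≡ u
      u*1≡u = solve-∀

  -- The cases `c = d = 2` and `c = d = 6`.

  -1-t : Bijection
  -1-t = affine -1ℤ -1ℤ -1≉0

  -- For `c = d` the quadratic is `1 + c t (t + 1)`, and `t ↦ -1 - t` exchanges `t` and `t + 1` up
  -- to sign.
  quadratic-symmetric : ∀ c t → quadratic c c (-1ℤ * t + -1ℤ) ≡ quadratic c c t
  quadratic-symmetric = symmetric
    where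
    symmetric : ∀ c t → 1ℤ + c * (-1ℤ * t + -1ℤ) + c * ((-1ℤ * t + -1ℤ) * ((-1ℤ * t + -1ℤ) * 1ℤ)) ≡
      1ℤ + c * t + c * (t * (t * 1ℤ))
    symmetric = solve-∀

  -- As q = 1 + 2 t + 2 t² has no zero, 2 t² / q = 1 - (1 + 2 t) / q,
  -- where (1 + 2 t) / q is odd about t = - 1 / 2.
  Σ-summand-2 : (∀ x → x * x ≉ -1ℤ) → Σₚ (summand (+ 2) (+ 2) 2) ≈ 0ℤ
  Σ-summand-2 nonsquare = *-cancelˡ-0 (Σₚ F) 2≉0 (begin
    + 2 * Σₚ F                         ≡⟨ Σₚ-* (+ 2) F ⟨
    Σₚ (λ t → + 2 * F t)               ≈⟨ Σₚ-cong pointwise ⟩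
    Σₚ (λ t → 1ℤ + -1ℤ * G t)          ≡⟨ Σₚ-+ (λ _ → 1ℤ) (λ t → -1ℤ * G t) ⟩
    Σₚ (λ _ → 1ℤ) + Σₚ (λ t → -1ℤ * G t)
      ≈⟨ +-cong Σₚ-1 (≈-trans (≈-reflexive (Σₚ-* -1ℤ G)) (*-zeroʳ -1ℤ (Σₚ-antisymmetric {G} G-cong -1-t G-antisymmetric))) ⟩
    0ℤ + 0ℤ                            ∎)
    where
    open ≈-Reasoning
    q = quadratic (+ 2) (+ 2)
    F = summand (+ 2) (+ 2) 2
    G : ℤ → ℤ
    G t = (1ℤ + + 2 * t) * inv (q t)

    G-cong : Congruent G
    G-cong x≈y = *-cong (+-cong (≈-refl {1ℤ}) (*-congˡ (+ 2) x≈y)) (inv-cong (quadratic-cong (+ 2) (+ 2) x≈y))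

    q≉0 : ∀ t → q t ≉ 0ℤ
    -- Completing the square: `(2 t + 1)² = 2 q - 1`.
    q≉0 t q≈0 = nonsquare (+ 2 * t + 1ℤ) (modulo (+ 2) q≈0 (complete-square t))
      where
      complete-square : ∀ t → (+ 2 * t + 1ℤ) * (+ 2 * t + 1ℤ) ≡ -1ℤ + + 2 * (1ℤ + + 2 * t + + 2 * (t * (t * 1ℤ)) - 0ℤ)
      complete-square = solve-∀

    pointwise : ∀ t → + 2 * F t ≈ 1ℤ + -1ℤ * G t
    pointwise t = modulo 1ℤ (fermat (q t) (q≉0 t)) (split t (inv (q t)))
      where
      split : ∀ t r → + 2 * (r * (t * (t * 1ℤ))) ≡
        1ℤ + -1ℤ * ((1ℤ + + 2 * t) * r) + 1ℤ * ((1ℤ + + 2 * t + + 2 * (t * (t * 1ℤ))) * r - 1ℤ)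
      split = solve-∀

    G-antisymmetric : ∀ t → G (-1ℤ * t + -1ℤ) ≈ -1ℤ * G t
    G-antisymmetric t = ≈-reflexive (trans
      (cong (λ u → (1ℤ + + 2 * (-1ℤ * t + -1ℤ)) * inv u) (quadratic-symmetric (+ 2) t))
      (odd t (inv (q t))))
      where
      odd : ∀ t r → (1ℤ + + 2 * (-1ℤ * t + -1ℤ)) * r ≡ -1ℤ * ((1ℤ + + 2 * t) * r)
      odd = solve-∀

  -- With s² = 3 the polynomial q = 1 + 6 t + 6 t² satisfies 2 q = (y - 1) (y + 1) for y = s (2 t + 1), and
  -- adding the summands at t and - 1 - t leads to the partial fraction expansion of (q + 2) / q.
  Σ-summand-6 : ∀ s → s * s ≈ + 3 → Σₚ (summand (+ 6) (+ 6) 2) ≈ 0ℤ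
  Σ-summand-6 s s²≈3 = *-cancelˡ-0 (Σₚ F) (*-nonzero 2≉0 3≉0) (begin
    + 6 * Σₚ F
      ≡⟨ double (Σₚ F) ⟩
    + 3 * (Σₚ F + Σₚ F)
      ≈⟨ *-congˡ (+ 3) (+-cong (≈-refl {Σₚ F}) (Σₚ-reindex (summand-cong (+ 6) (+ 6) 2) -1-t)) ⟩
    + 3 * (Σₚ F + Σₚ (λ t → F (-1ℤ * t + -1ℤ)))
      ≡⟨ cong (+ 3 *_) (Σₚ-+ F (λ t → F (-1ℤ * t + -1ℤ))) ⟨
    + 3 * Σₚ (λ t → F t + F (-1ℤ * t + -1ℤ))
      ≡⟨ Σₚ-* (+ 3) (λ t → F t + F (-1ℤ * t + -1ℤ)) ⟨
    Σₚ (λ t → + 3 * (F t + F (-1ℤ * t + -1ℤ)))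
      ≈⟨ Σₚ-cong pointwise ⟩
    Σₚ (λ t → 1ℤ + (+ 2 * inv (a t) + - (+ 2) * inv (b t)))
      ≡⟨ Σₚ-+ (λ _ → 1ℤ) (λ t → + 2 * inv (a t) + - (+ 2) * inv (b t)) ⟩
    Σₚ (λ _ → 1ℤ) + Σₚ (λ t → + 2 * inv (a t) + - (+ 2) * inv (b t))
      ≡⟨ cong (λ u → Σₚ (λ _ → 1ℤ) + u) (Σₚ-+ (λ t → + 2 * inv (a t)) (λ t → - (+ 2) * inv (b t))) ⟩
    Σₚ (λ _ → 1ℤ) + (Σₚ (λ t → + 2 * inv (a t)) + Σₚ (λ t → - (+ 2) * inv (b t)))
      ≈⟨ +-cong Σₚ-1 (+-cong (vanishes (+ 2) (s - 1ℤ)) (vanishes (- (+ 2)) (s + 1ℤ))) ⟩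
    0ℤ ∎)
    where
    open ≈-Reasoning
    q = quadratic (+ 6) (+ 6)
    F = summand (+ 6) (+ 6) 2
    a b : ℤ → ℤ
    a t = + 2 * s * t + (s - 1ℤ)
    b t = + 2 * s * t + (s + 1ℤ)

    double : ∀ x → + 6 * x ≡ + 3 * (x + x)
    double = solve-∀

    2s≉0 : + 2 * s ≉ 0ℤ
    2s≉0 = *-nonzero 2≉0 λ s≈0 → 3≉0 (≈-trans (≈-sym s²≈3) (*-zeroˡ s s≈0))

    vanishes : ∀ c r → Σₚ (λ t → c * inv (+ 2 * s * t + r)) ≈ 0ℤ
    vanishes c r = ≈-trans (≈-reflexive (Σₚ-* c (λ t → inv (+ 2 * s * t + r)))) (*-zeroʳ c (Σₚ-inv-affine (+ 2 * s) r 2s≉0))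

    ab≈2q : ∀ t → a t * b t ≈ + 2 * q t
    ab≈2q t = modulo ((+ 2 * t + 1ℤ) * (+ 2 * t + 1ℤ)) s²≈3 (expand s t)
      where
      expand : ∀ s t → (+ 2 * s * t + (s - 1ℤ)) * (+ 2 * s * t + (s + 1ℤ)) ≡
        + 2 * (1ℤ + + 6 * t + + 6 * (t * (t * 1ℤ))) + (+ 2 * t + 1ℤ) * (+ 2 * t + 1ℤ) * (s * s - + 3)
      expand = solve-∀

    b≡a+2 : ∀ t → b t ≡ a t + + 2
    b≡a+2 t = shift s t
      where
      shift : ∀ s t → + 2 * s * t + (s + 1ℤ) ≡ + 2 * s * t + (s - 1ℤ) + + 2
      shift = solve-∀

    -- The numerator comes from `3 (t² + (t + 1)²) = q + 2`.
    symmetrized : ∀ t → + 3 * (F t + F (-1ℤ * t + -1ℤ)) ≡ (q t + + 2) * inv (q t)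
    symmetrized t = trans
      (cong (λ u → + 3 * (F t + inv u * (-1ℤ * t + -1ℤ) ^ 2)) (quadratic-symmetric (+ 6) t))
      (collect t (inv (q t)))
      where
      collect : ∀ t r → + 3 * (r * (t * (t * 1ℤ)) + r * ((-1ℤ * t + -1ℤ) * ((-1ℤ * t + -1ℤ) * 1ℤ))) ≡
        (1ℤ + + 6 * t + + 6 * (t * (t * 1ℤ)) + + 2) * r
      collect = solve-∀

    -- For invertible `a` and `b = a + 2`, `2 / a - 2 / b = 4 / (a b) = 2 / q`. If one of them is 0,
    -- so is `q`, and with `inv` zero there the left side vanishes; the other is then 2 or -2, and
    -- its fraction cancels the 1 on the right.
    partial-fractions : ∀ q a → a * (a + + 2) ≈ + 2 * q → (q + + 2) * inv q ≈ 1ℤ + (+ 2 * inv a + - (+ 2) * inv (a + + 2))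
    partial-fractions q a ab≈2q with a ≈? 0ℤ | (a + + 2) ≈? 0ℤ
    ... | yes a≈0 | _ = ≈-trans (*-zeroʳ (q + + 2) (inv-zero q≈0)) (≈-sym (begin
      1ℤ + (+ 2 * inv a + - (+ 2) * inv (a + + 2))
        ≈⟨ +-cong (≈-refl {1ℤ}) (+-cong (*-congˡ (+ 2) (inv-zero a≈0))
             (*-congˡ (- (+ 2)) (inv-cong (+-cong a≈0 (≈-refl {+ 2}))))) ⟩
      1ℤ + (+ 2 * 0ℤ + - (+ 2) * inv (+ 2))
        ≈⟨ modulo -1ℤ (fermat (+ 2) 2≉0) (cancel (inv (+ 2))) ⟩
      0ℤ ∎))
      where
      q≈0 : q ≈ 0ℤ
      q≈0 = *-cancelˡ-0 q 2≉0 (≈-trans (≈-sym ab≈2q) (*-zeroˡ (a + + 2) a≈0))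
      cancel : ∀ h → 1ℤ + (+ 2 * 0ℤ + - (+ 2) * h) ≡ 0ℤ + -1ℤ * (+ 2 * h - 1ℤ)
      cancel = solve-∀
    ... | no _ | yes b≈0 = ≈-trans (*-zeroʳ (q + + 2) (inv-zero q≈0)) (≈-sym (begin
      1ℤ + (+ 2 * inv a + - (+ 2) * inv (a + + 2))
        ≈⟨ +-cong (≈-refl {1ℤ}) (+-cong (*-congˡ (+ 2) (≈-trans (inv-cong (modulo 1ℤ b≈0 (a≡ a))) (inv-neg (+ 2))))
             (*-congˡ (- (+ 2)) (inv-zero b≈0))) ⟩
      1ℤ + (+ 2 * - inv (+ 2) + - (+ 2) * 0ℤ)
        ≈⟨ modulo -1ℤ (fermat (+ 2) 2≉0) (cancel (inv (+ 2))) ⟩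
      0ℤ ∎))
      where
      q≈0 : q ≈ 0ℤ
      q≈0 = *-cancelˡ-0 q 2≉0 (≈-trans (≈-sym ab≈2q) (*-zeroʳ a b≈0))
      a≡ : ∀ a → a ≡ - (+ 2) + 1ℤ * (a + + 2 - 0ℤ)
      a≡ = solve-∀
      cancel : ∀ h → 1ℤ + (+ 2 * - h + - (+ 2) * 0ℤ) ≡ 0ℤ + -1ℤ * (+ 2 * h - 1ℤ)
      cancel = solve-∀
    ... | no a≉0 | no b≉0 = begin
      (q + + 2) * inv q
        ≈⟨ *-congˡ (q + + 2) (inv-unique (+ 2 * u * v) q*2uv≈1) ⟩
      (q + + 2) * (+ 2 * u * v)
        ≈⟨ modulo 1ℤ q*2uv≈1 (split q u v) ⟩
      1ℤ + + 4 * u * v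
        ≈⟨ modulo (- (+ 2) * v) au≈1 (first a u v) ⟩
      1ℤ + (+ 4 * u * v + + 2 * a * u * v + - (+ 2) * v)
        ≈⟨ modulo (+ 2 * u) bv≈1 (second a u v) ⟩
      1ℤ + (+ 2 * u + - (+ 2) * v) ∎
      where
      u = inv a
      v = inv (a + + 2)
      au≈1 : a * u ≈ 1ℤ
      au≈1 = fermat a a≉0
      bv≈1 : (a + + 2) * v ≈ 1ℤ
      bv≈1 = fermat (a + + 2) b≉0
      q*2uv≈1 : q * (+ 2 * u * v) ≈ 1ℤ
      q*2uv≈1 = begin
        q * (+ 2 * u * v)          ≡⟨ pull q u v ⟩
        + 2 * q * (u * v)          ≈⟨ *-congʳ (u * v) ab≈2q ⟨
        a * (a + + 2) * (u * v)    ≡⟨ interchange a (a + + 2) u v ⟩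
        a * u * ((a + + 2) * v)    ≈⟨ *-cong au≈1 bv≈1 ⟩
        1ℤ                         ∎
        where
        pull : ∀ q u v → q * (+ 2 * u * v) ≡ + 2 * q * (u * v)
        pull = solve-∀
        interchange : ∀ a b c d → a * b * (c * d) ≡ a * c * (b * d)
        interchange = solve-∀
      split : ∀ q u v → (q + + 2) * (+ 2 * u * v) ≡ 1ℤ + + 4 * u * v + 1ℤ * (q * (+ 2 * u * v) - 1ℤ)
      split = solve-∀
      first : ∀ a u v → 1ℤ + + 4 * u * v ≡
        1ℤ + (+ 4 * u * v + + 2 * a * u * v + - (+ 2) * v) + - (+ 2) * v * (a * u - 1ℤ)
      first = solve-∀
      second : ∀ a u v → 1ℤ + (+ 4 * u * v + + 2 * a * u * v + - (+ 2) * v) ≡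
        1ℤ + (+ 2 * u + - (+ 2) * v) + + 2 * u * ((a + + 2) * v - 1ℤ)
      second = solve-∀

    pointwise : ∀ t → + 3 * (F t + F (-1ℤ * t + -1ℤ)) ≈ 1ℤ + (+ 2 * inv (a t) + - (+ 2) * inv (b t))
    pointwise t = begin
      + 3 * (F t + F (-1ℤ * t + -1ℤ))
        ≡⟨ symmetrized t ⟩
      (q t + + 2) * inv (q t)
        ≈⟨ partial-fractions (q t) (a t) (subst (λ z → a t * z ≈ + 2 * q t) (b≡a+2 t) (ab≈2q t)) ⟩
      1ℤ + (+ 2 * inv (a t) + - (+ 2) * inv (a t + + 2))
        ≡⟨ cong (λ z → 1ℤ + (+ 2 * inv (a t) + - (+ 2) * inv z)) (b≡a+2 t) ⟨
      1ℤ + (+ 2 * inv (a t) + - (+ 2) * inv (b t)) ∎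

  -- By `fermat²`, `x² = x ^ (p + 1)`, which is the power of `x² = -1` with exponent `(p + 1) / 2`.
  -- That exponent is even, so `-1 = 1`.
  -1-nonsquare : ∀ r → 3 ℕ.+ n ≡ r ℕ.* 2 ℕ.* 2 → ∀ x → x * x ≉ -1ℤ
  -1-nonsquare r n+3≡4r x x²≈-1 = 2≉0 (modulo 1ℤ 1≈-1 refl)
    where
    open ≈-Reasoning
    square : ∀ x → x * (x * 1ℤ) ≡ x * x
    square = solve-∀
    1≈-1 : 1ℤ ≈ -1ℤ
    1≈-1 = begin
      1ℤ                          ≡⟨ -1^even r ⟨
      -1ℤ ^ (r ℕ.* 2)             ≈⟨ ^-cong (r ℕ.* 2) x²≈-1 ⟨
      (x * x) ^ (r ℕ.* 2)         ≡⟨ cong (_^ (r ℕ.* 2)) (square x) ⟨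
      (x ^ 2) ^ (r ℕ.* 2)         ≡⟨ ^-even x (r ℕ.* 2) ⟨
      x ^ (r ℕ.* 2 ℕ.* 2)         ≡⟨ cong (x ^_) n+3≡4r ⟨
      x ^ (3 ℕ.+ n)               ≈⟨ fermat² x ⟩
      x * x                       ≈⟨ x²≈-1 ⟩
      -1ℤ                         ∎

-- The residue conditions on `p`, and the conclusion.

-- Shaped so that `r * 2` is the even exponent `k = (p + 1) / 2` of the case `d = -1`. Since
-- `p + 1 = (p - 3) + 4`, `r` is one more than the quotient of `p - 3` by 4.
p≡3⇒p+1≡4r : ∀ p → p > 3 → + p ≡ + 3 [mod 4 ] → ∃ λ r → 0 < r ℕ.* 2 × suc p ≡ r ℕ.* 2 ℕ.* 2
p≡3⇒p+1≡4r (suc (suc (suc (suc m)))) p>3 p≡3 with ∣⇒∣ᵤ p≡3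
... | ℕ.divides q p-3≡4q = suc q , z<s , trans (cong (4 ℕ.+_) p-3≡4q) (sym (ℕ.*-assoc (suc q) 2 2))
p≡3⇒p+1≡4r (suc (suc (suc zero))) (s≤s (s≤s (s≤s ())))
p≡3⇒p+1≡4r (suc (suc zero)) (s≤s (s≤s ()))
p≡3⇒p+1≡4r (suc zero) (s≤s ())

theorem1p8 : ∀ (p : ℕ) → Prime p → p > 3 →
    (+ p ≡ + 3 [mod 4 ] → ∀ (c : ℤ) → D p c -1ℤ ≡ 0ℤ [mod p ])
    ×
    ((+ p ≡ + 3 [mod 4 ] → D p (+ 2) (+ 2) ≡ 0ℤ [mod p ])
    ×
    (+ p ≡ 1ℤ [mod 12 ] ⊎ + p ≡ -1ℤ [mod 12 ] → D p (+ 6) (+ 6) ≡ 0ℤ [mod p ]))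
theorem1p8 (suc zero) _ (s≤s ())
theorem1p8 (suc (suc n)) p-prime p>3 = part-i , part-ii-2 , part-ii-6
  where
  open PrimeField n p-prime p>3

  part-i : + p ≡ + 3 [mod 4 ] → ∀ c → D p c -1ℤ ≡ 0ℤ [mod p ]
  part-i p≡3 c = let r , 0<2r , p+1≡4r = p≡3⇒p+1≡4r p p>3 p≡3 in
    D-vanishes c -1ℤ 0<2r (Σ-summand-d≡-1 c (r ℕ.* 2) 0<2r p+1≡4r (-1^even r))

  part-ii-2 : + p ≡ + 3 [mod 4 ] → D p (+ 2) (+ 2) ≡ 0ℤ [mod p ]
  part-ii-2 p≡3 = let r , _ , p+1≡4r = p≡3⇒p+1≡4r p p>3 p≡3 in
    D-vanishes (+ 2) (+ 2) {2} z<s (Σ-summand-2 (-1-nonsquare r p+1≡4r))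

  sqrt3 : + p ≡ 1ℤ [mod 12 ] ⊎ + p ≡ -1ℤ [mod 12 ] → ∃ λ s → s * s ≈ + 3
  sqrt3 (inj₁ p≡1) with ∣⇒∣ᵤ p≡1
  ... | ℕ.divides q p-1≡12q = sqrt3-p≡1 q p-1≡12q
  sqrt3 (inj₂ p≡-1) with ∣⇒∣ᵤ p≡-1
  ... | ℕ.divides q p+1≡12q = sqrt3-p≡-1 q (trans (ℕ.+-comm 1 p) p+1≡12q)

  part-ii-6 : + p ≡ 1ℤ [mod 12 ] ⊎ + p ≡ -1ℤ [mod 12 ] → D p (+ 6) (+ 6) ≡ 0ℤ [mod p ]
  part-ii-6 p≡±1 = let s , s²≈3 = sqrt3 p≡±1 in
    D-vanishes (+ 6) (+ 6) {2} z<s (Σ-summand-6 s s²≈3)
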